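{- For all $a,m\ge 2$, $1^a23\cdots m\equiv 12\cdots(m-1)m^a$ as subwords on $NC_n$; that is, for every $n\ge 0$ and every $k\ge 0$, the number of $\pi\in NC_n$ having exactly $k$ occurrences of the subword $1^a23\cdots m$ equals the number of $\pi\in NC_n$ having exactly $k$ occurrences of the subword $12\cdots(m-1)m^a$.
   Context: A set partition of $[n]=\{1,\dots,n\}$ with blocks $B_1,\dots,B_k$ ordered so that $\min B_1<\cdots<\min B_k$ is represented by its canonical sequential form $\pi=\pi_1\cdots\pi_n$, where $i\in B_{\pi_i}$ for each $i$. It is non-crossing if $\pi$ contains no (not necessarily consecutive) subsequence of the form $a\,b\,a\,b$ with $a<b$. $NC_n$ denotes the set of non-crossing partitions of $[n]$, identified with their canonical sequential forms. An occurrence of a word $\tau=\tau_1\cdots\tau_k$ as a subword in a sequence $\sigma_1\cdots\sigma_n$ is an index $i\in[n-k+1]$ such that the string of consecutive letters $\sigma_i\cdots\sigma_{i+k-1}$ is order-isomorphic to $\tau$ (same relative order, including equalities). Here $1^a23\cdots m$ denotes $a$ copies of $1$ followed by $2,3,\dots,m$, and $12\cdots(m-1)m^a$ denotes $1,2,\dots,m-1$ followed by $a$ copies of $m$. -}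

module Defs where

open import Data.Bool.Base using (true)
open import Data.Fin.Base as Fin using (Fin; toℕ; fromℕ<; cast)
open import Data.Fin.Properties as Finₚ using (any?; all?)
open import Data.Fin.Subset as Subset using (Subset)
open import Data.List.Base
  using (List; []; _∷_; _++_; length; lookup; map; filter; upTo; replicate;
         take; drop; cartesianProductWith)
open import Data.List.Membership.Propositional using (_∈_)
open import Data.List.Membership.Propositional.Properties
  using (∈-map⁺; ∈-upTo⁺; ∈-filter⁺; ∈-filter⁻;
         ∈-cartesianProductWith⁺; ∈-cartesianProductWith⁻)
open import Data.List.Properties using (∷-injective)
open import Data.List.Relation.Binary.Sublist.DecPropositional using (_⊆?_)
open import Data.List.Relation.Binary.Sublist.Propositional as Sublist using (_⊆_)
open import Data.List.Relation.Unary.All as All using (All; []; _∷_)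
open import Data.List.Relation.Unary.AllPairs using ([]; _∷_)
open import Data.List.Relation.Unary.Any using (here; there)
open import Data.List.Relation.Unary.Unique.Propositional using (Unique)
import Data.List.Relation.Unary.Unique.Propositional.Properties as Uniqueₚ
open import Data.Nat.Base using (ℕ; zero; suc; _+_; _∸_; _≤_; _<_; z≤n; s≤s)
open import Data.Nat.Properties as ℕₚ using (_≟_; _<?_)
open import Data.Product.Base using (Σ-syntax; ∃; ∃-syntax; _×_; _,_; proj₁; proj₂)
open import Data.Vec.Base using (tabulate)
open import Data.Vec.Properties
  using (lookup∘tabulate; lookup⇒[]=; []=⇒lookup)
open import Function.Base using (_∘_)
open import Function.Bundles using (_⇔_; mk⇔; Equivalence)
open import Relation.Binary.PropositionalEquality
  using (_≡_; refl; sym; trans; cong; subst)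
open import Relation.Nullary.Decidable
  using (Dec; yes; no; ¬?; does; map′; _×-dec_; _→-dec_; dec-true)
open import Relation.Nullary.Negation using (¬_; contradiction)
open import Relation.Unary using (Decidable)

Word : Set
Word = List ℕ

-- The ground set [n] is Fin n (position i stands for i + 1), and B b is the
-- block B_{b+1}.  `min` being a member of each block makes the blocks nonempty.
record SetPartition (n : ℕ) : Set where
  field
    size     : ℕ
    B        : Fin size → Subset n
    disjoint : ∀ {b c i} → i Subset.∈ B b → i Subset.∈ B c → b ≡ c
    cover    : ∀ i → ∃[ b ] i Subset.∈ B b
    min      : Fin size → Fin n
    min∈     : ∀ b → min b Subset.∈ B b
    min≤     : ∀ {b i} → i Subset.∈ B b → min b Fin.≤ i
    ordered  : ∀ {b c} → b Fin.< c → min b Fin.< min c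

-- Letters are 1-based.
Represents : (π : Word) → SetPartition (length π) → Set
Represents π P = ∀ i → ∃[ b ] lookup π i ≡ suc (toℕ b) × i Subset.∈ B b
  where open SetPartition P

CanonicalSequentialForm : Word → Set
CanonicalSequentialForm π = ∃[ P ] Represents π P

NonCrossing : Word → Set
NonCrossing π = ∀ a b → a < b → ¬ (a ∷ b ∷ a ∷ b ∷ [] ⊆ π)

OrderIsomorphic : Word → Word → Set
OrderIsomorphic u v = Σ[ e ∈ length u ≡ length v ]
  ∀ s t → (lookup u s < lookup u t ⇔ lookup v (cast e s) < lookup v (cast e t))
        × (lookup u s ≡ lookup u t ⇔ lookup v (cast e s) ≡ lookup v (cast e t))

-- i is the number of letters preceding the window.
OccursAt : Word → Word → ℕ → Set
OccursAt τ σ i = OrderIsomorphic (take (length τ) (drop i σ)) τ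

private
  _⇔-dec_ : ∀ {A B : Set} → Dec A → Dec B → Dec (A ⇔ B)
  A? ⇔-dec B? = map′ (λ (f , g) → mk⇔ f g)
                     (λ e → Equivalence.to e , Equivalence.from e)
                     ((A? →-dec B?) ×-dec (B? →-dec A?))

  holds : ∀ {A : Set} (A? : Dec A) → does A? ≡ true → A
  holds (yes a) _ = a

  least : ∀ {n} {Q : Fin n → Set} → Decidable Q → ∃ Q →
          ∃[ i ] Q i × (∀ {j} → Q j → i Fin.≤ j)
  least {suc n} Q? (i , q) with Q? Fin.zero
  ... | yes q₀ = Fin.zero , q₀ , λ _ → z≤n
  least {suc n} Q? (Fin.zero  , q) | no ¬q₀ = contradiction q ¬q₀
  least {suc n} Q? (Fin.suc i , q) | no ¬q₀
    with k , qk , k≤ ← least (Q? ∘ Fin.suc) (i , q) =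
    Fin.suc k , qk , λ { {Fin.zero} q₀ → contradiction q₀ ¬q₀
                       ; {Fin.suc j} qj → s≤s (k≤ qj) }

-- A description of canonical sequential forms with k blocks by quantifiers
-- over finite sets only.
record HasBlocks (π : Word) (k : ℕ) : Set where
  constructor hasBlocks
  field
    letters : ∀ i → ∃[ b ] lookup π i ≡ suc (toℕ {k} b)
    used    : ∀ b → ∃[ i ] lookup π i ≡ suc (toℕ {k} b)
    earlier : ∀ (b c : Fin k) → b Fin.< c → ∀ j → lookup π j ≡ suc (toℕ c) →
              ∃[ i ] i Fin.< j × lookup π i ≡ suc (toℕ b)

hasBlocks? : ∀ π k → Dec (HasBlocks π k)
hasBlocks? π k = map′ (λ (l , u , e) → hasBlocks l u e)
                      (λ (hasBlocks l u e) → l , u , e)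
  (all? (λ i → any? (λ b → lookup π i ≟ suc (toℕ b))) ×-dec
   all? (λ b → any? (λ i → lookup π i ≟ suc (toℕ b))) ×-dec
   all? (λ b → all? (λ c → (b Finₚ.<? c) →-dec
     all? (λ j → (lookup π j ≟ suc (toℕ c)) →-dec
       any? (λ i → (i Finₚ.<? j) ×-dec (lookup π i ≟ suc (toℕ b)))))))

private
  min-injective : ∀ {n} (P : SetPartition n) {b c} →
                  SetPartition.min P b ≡ SetPartition.min P c → b ≡ c
  min-injective P {b} {c} eq = disjoint (min∈ b) (subst (Subset._∈ B c) (sym eq) (min∈ c))
    where open SetPartition P

size≤ : ∀ {n} (P : SetPartition n) → SetPartition.size P ≤ n
size≤ P = Finₚ.injective⇒≤ (min-injective P)

csf⇒hasBlocks : ∀ {π} ((P , _) : CanonicalSequentialForm π) →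
                HasBlocks π (SetPartition.size P)
csf⇒hasBlocks {π} (P , rep) = hasBlocks
  (λ i → let b , eq , _ = rep i in b , eq)
  (λ b → min b , letter (min∈ b))
  (λ b c b<c j eq → min b , ℕₚ.<-≤-trans (ordered b<c) (min≤ (member eq)) , letter (min∈ b))
  where
  open SetPartition P
  letter : ∀ {i b} → i Subset.∈ B b → lookup π i ≡ suc (toℕ b)
  letter {i} i∈b = let c , eq , i∈c = rep i in
    trans eq (cong (suc ∘ toℕ) (disjoint i∈c i∈b))
  member : ∀ {i b} → lookup π i ≡ suc (toℕ b) → i Subset.∈ B b
  member {i} eq = let c , eq₁ , i∈c = rep i in
    subst (λ d → i Subset.∈ B d)
          (Finₚ.toℕ-injective (ℕₚ.suc-injective (trans (sym eq₁) eq))) i∈c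

hasBlocks⇒csf : ∀ {π k} → HasBlocks π k → CanonicalSequentialForm π
hasBlocks⇒csf {π} {k} (hasBlocks letters used earlier) = P , rep
  where
  here? : ∀ (b : Fin k) → Decidable (λ i → lookup π i ≡ suc (toℕ b))
  here? b i = lookup π i ≟ suc (toℕ b)

  block : Fin k → Subset (length π)
  block b = tabulate (λ i → does (here? b i))

  ∈⁺ : ∀ {i b} → lookup π i ≡ suc (toℕ b) → i Subset.∈ block b
  ∈⁺ {i} {b} eq = lookup⇒[]= i _ (trans (lookup∘tabulate _ i) (dec-true (here? b i) eq))

  ∈⁻ : ∀ {i b} → i Subset.∈ block b → lookup π i ≡ suc (toℕ b)
  ∈⁻ {i} {b} i∈ = holds (here? b i) (trans (sym (lookup∘tabulate _ i)) ([]=⇒lookup i∈))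

  first : ∀ b → ∃[ i ] lookup π i ≡ suc (toℕ b) ×
                (∀ {j} → lookup π j ≡ suc (toℕ b) → i Fin.≤ j)
  first b = least (here? b) (used b)

  P : SetPartition (length π)
  P = record
    { size     = k
    ; B        = block
    ; disjoint = λ i∈b i∈c →
        Finₚ.toℕ-injective (ℕₚ.suc-injective (trans (sym (∈⁻ i∈b)) (∈⁻ i∈c)))
    ; cover    = λ i → let b , eq = letters i in b , ∈⁺ eq
    ; min      = λ b → proj₁ (first b)
    ; min∈     = λ b → ∈⁺ (proj₁ (proj₂ (first b)))
    ; min≤     = λ {b} i∈ → proj₂ (proj₂ (first b)) (∈⁻ i∈)
    ; ordered  = λ {b} {c} b<c →
        let i , i<j , eq = earlier b c b<c _ (proj₁ (proj₂ (first c)))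
        in ℕₚ.≤-<-trans (proj₂ (proj₂ (first b)) eq) i<j
    }

  rep : Represents π P
  rep i = let b , eq = letters i in b , eq , ∈⁺ eq

csf? : Decidable CanonicalSequentialForm
csf? π = map′
  (λ (k , h) → hasBlocks⇒csf h)
  (λ c@(P , _) → fromℕ< (s≤s (size≤ P)) ,
     subst (HasBlocks π) (sym (Finₚ.toℕ-fromℕ< (s≤s (size≤ P)))) (csf⇒hasBlocks c))
  (any? {suc (length π)} (λ k → hasBlocks? π (toℕ k)))

nonCrossing? : Decidable NonCrossing
nonCrossing? π = map′ to from
  (All.all? (λ a → All.all? (λ b → (a <? b) →-dec ¬? (_⊆?_ _≟_ (a ∷ b ∷ a ∷ b ∷ []) π)) π) π)
  where
  to : All (λ a → All (λ b → a < b → ¬ (a ∷ b ∷ a ∷ b ∷ [] ⊆ π)) π) π → NonCrossing π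
  to h a b a<b sub = All.lookup (All.lookup h (Sublist.lookup sub (here refl)))
                       (Sublist.lookup sub (there (here refl))) a<b sub
  from : NonCrossing π → All (λ a → All (λ b → a < b → ¬ (a ∷ b ∷ a ∷ b ∷ [] ⊆ π)) π) π
  from h = All.tabulate (λ {a} _ → All.tabulate (λ {b} _ → h a b))

orderIsomorphic? : ∀ u v → Dec (OrderIsomorphic u v)
orderIsomorphic? u v with length u ≟ length v
... | no  ¬e = no (¬e ∘ proj₁)
... | yes e  = map′ (e ,_) proj₂
  (all? λ s → all? λ t →
    ((lookup u s <? lookup u t) ⇔-dec (lookup v (cast e s) <? lookup v (cast e t))) ×-dec
    ((lookup u s ≟ lookup u t) ⇔-dec (lookup v (cast e s) ≟ lookup v (cast e t))))

occursAt? : ∀ τ σ → Decidable (OccursAt τ σ)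
occursAt? τ σ i = orderIsomorphic? (take (length τ) (drop i σ)) τ

-- There are suc n ∸ k starting positions for a window of length k.
occurrences : Word → Word → ℕ
occurrences τ σ = length (filter (occursAt? τ σ) (upTo (suc (length σ) ∸ length τ)))

wordsOver : List ℕ → ℕ → List Word
wordsOver ls zero    = [] ∷ []
wordsOver ls (suc n) = cartesianProductWith _∷_ ls (wordsOver ls n)

-- A partition of [n] has at most n blocks, so searching the words of length n
-- over the letters 1, …, n is exhaustive; see ∈-NC and NC-unique.
NC : ℕ → List Word
NC n = filter (λ π → csf? π ×-dec nonCrossing? π) (wordsOver (map suc (upTo n)) n)

countNC : Word → ℕ → ℕ → ℕ
countNC τ n k = length (filter (λ π → occurrences τ π ≟ k) (NC n))

infix 4 _≡ₛ_
_≡ₛ_ : Word → Word → Set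
τ ≡ₛ ρ = ∀ n k → countNC τ n k ≡ countNC ρ n k

-- 1ᵃ 2 3 ⋯ m
pattern₁ : ℕ → ℕ → Word
pattern₁ a m = replicate a 1 ++ map (2 +_) (upTo (m ∸ 1))

-- 1 2 ⋯ (m-1) mᵃ
pattern₂ : ℕ → ℕ → Word
pattern₂ a m = map suc (upTo (m ∸ 1)) ++ replicate a m

-- NC n enumerates, without repetition, exactly the canonical sequential forms
-- of the non-crossing partitions of [n].

∈-wordsOver⁺ : ∀ {ls π} → All (_∈ ls) π → π ∈ wordsOver ls (length π)
∈-wordsOver⁺ []       = here refl
∈-wordsOver⁺ (x∈ ∷ h) = ∈-cartesianProductWith⁺ _∷_ x∈ (∈-wordsOver⁺ h)

∈-wordsOver⇒length : ∀ ls n {π} → π ∈ wordsOver ls n → length π ≡ n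
∈-wordsOver⇒length ls zero    (here refl) = refl
∈-wordsOver⇒length ls (suc n) π∈
  with _ , _ , _ , π∈₁ , refl ← ∈-cartesianProductWith⁻ _∷_ ls (wordsOver ls n) π∈
  = cong suc (∈-wordsOver⇒length ls n π∈₁)

wordsOver-unique : ∀ {ls} → Unique ls → ∀ n → Unique (wordsOver ls n)
wordsOver-unique ls! zero    = [] ∷ []
wordsOver-unique ls! (suc n) =
  Uniqueₚ.cartesianProductWith⁺ _∷_ ∷-injective ls! (wordsOver-unique ls! n)

private
  tabulateAll : ∀ {Q : ℕ → Set} xs → (∀ i → Q (lookup xs i)) → All Q xs
  tabulateAll []       h = []
  tabulateAll (x ∷ xs) h = h Fin.zero ∷ tabulateAll xs (h ∘ Fin.suc)

  csf⇒letters : ∀ {π} → CanonicalSequentialForm π → All (_∈ map suc (upTo (length π))) π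
  csf⇒letters {π} (P , rep) = tabulateAll π λ i →
    let b , eq , _ = rep i in
    subst (_∈ _) (sym eq) (∈-map⁺ suc (∈-upTo⁺ (ℕₚ.<-≤-trans (Finₚ.toℕ<n b) (size≤ P))))

∈-NC : ∀ n π → π ∈ NC n ⇔ (length π ≡ n × CanonicalSequentialForm π × NonCrossing π)
∈-NC n π = mk⇔
  (λ π∈ → let π∈₁ , c , nc = ∈-filter⁻ NC? π∈ in
          ∈-wordsOver⇒length (map suc (upTo n)) n π∈₁ , c , nc)
  (λ { (refl , c , nc) → ∈-filter⁺ NC? (∈-wordsOver⁺ (csf⇒letters c)) (c , nc) })
  where
  NC? : Decidable (λ π → CanonicalSequentialForm π × NonCrossing π)
  NC? π = csf? π ×-dec nonCrossing? π

NC-unique : ∀ n → Unique (NC n)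
NC-unique n = Uniqueₚ.filter⁺ _
  (wordsOver-unique (Uniqueₚ.map⁺ ℕₚ.suc-injective (Uniqueₚ.upTo⁺ n)) n)

{-# OPTIONS --safe #-}
-- The letter following π₁ ⋯ πᵢ in the canonical form of a non-crossing partition
-- is either new (an ascent), or πᵢ again, or a smaller letter (a descent) that is
-- still available; a letter is available as long as no smaller one follows it.
-- Hence π is encoded by its sequence of steps U (new letter), F (repetition) and
-- D y (descent to y).  A maximal block of U's and F's changes the set of available
-- letters in a way that depends on the number of U's only, so reversing each such
-- block is an involution on NCₙ.  An occurrence of 1ᵃ23⋯m is a factor Fᵃ⁻¹Uᵐ⁻¹ of
-- the step sequence, an occurrence of 12⋯(m-1)mᵃ a factor Uᵐ⁻¹Fᵃ⁻¹, and the
-- involution interchanges the two.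
module Submission where

open import Defs
open import Data.Bool.Base using (Bool; true; false; if_then_else_)
import Data.Bool.Properties as Boolₚ
open import Data.Empty using (⊥)
open import Data.Fin.Base as Fin using (Fin; zero; suc; toℕ; fromℕ<; cast)
open import Data.Fin.Properties using (toℕ-fromℕ<; toℕ<n)
open import Data.List.Base as List
  using (List; []; _∷_; _++_; length; lookup; map; filter; upTo; applyUpTo;
         replicate; reverse; foldl)
open import Data.List.Membership.Propositional using (_∈_)
open import Data.List.Membership.Propositional.Properties
  using (∈-∃++; ∈-++⁺ˡ; ∈-++⁺ʳ; ∈-++⁻; ∈-filter⁺; ∈-filter⁻; ∈-lookup)
open import Data.List.Properties
  using (∷-injectiveʳ; ≡-dec; foldl-∷ʳ; length-++-sucʳ;
         length-reverse; length-take; map-upTo; reverse-++; reverse-injective;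
         reverse-involutive; unfold-reverse)
open import Data.List.Relation.Binary.Sublist.Propositional as Sublist
  using (_⊆_; []; _∷_; from∈; to∈) renaming (_∷ʳ_ to skip)
open import Data.List.Relation.Unary.All as All using (All; []; _∷_)
open import Data.List.Relation.Unary.AllPairs using ([]; _∷_)
open import Data.List.Relation.Unary.Any using (here; there)
open import Data.List.Relation.Unary.Unique.Propositional using (Unique)
import Data.List.Relation.Unary.Unique.Propositional.Properties as Uniqueₚ
open import Data.Nat.Base
  using (ℕ; zero; suc; _+_; _∸_; _≤_; _<_; z≤n; s≤s; z<s; s<s; s≤s⁻¹)
open import Data.Nat.Properties
open import Data.Product.Base
  using (∃-syntax; ∃₂; _×_; _,_; proj₁; proj₂; map₂)
open import Data.Sum.Base using (_⊎_; inj₁; inj₂)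
open import Data.Unit.Base using (⊤; tt)
open import Function.Base using (_∘_; id)
open import Function.Bundles using (_⇔_; mk⇔; Equivalence)
open import Relation.Binary.Definitions using (tri<; tri≈; tri>)
open import Relation.Binary.PropositionalEquality
  using (_≡_; _≢_; refl; sym; trans; cong; cong₂; subst; module ≡-Reasoning)
open import Relation.Nullary.Decidable using (Dec; does; yes; no; map′)
open import Relation.Nullary.Negation using (¬_; contradiction)
open import Relation.Unary using (Decidable)

open Equivalence using (to; from)

-- Restricted growth

-- RGF M w: the word w can follow a prefix with letters 1, …, M.
data RGF (M : ℕ) : Word → Set where
  []  : RGF M []
  old : ∀ {x w} → 0 < x → x ≤ M → RGF M w → RGF M (x ∷ w)
  new : ∀ {w} → RGF (suc M) w → RGF M (suc M ∷ w)

-- HasBlocks π k for a word π that follows a prefix with letters 1, …, M.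
record HasBlocksAbove (M : ℕ) (π : Word) (k : ℕ) : Set where
  constructor hasBlocksAbove
  field
    letters : ∀ i → ∃[ b ] lookup π i ≡ suc (toℕ {k} b)
    used    : ∀ b → M ≤ toℕ b → ∃[ i ] lookup π i ≡ suc (toℕ {k} b)
    earlier : ∀ (b c : Fin k) → M ≤ toℕ b → b Fin.< c → ∀ j → lookup π j ≡ suc (toℕ c) →
              ∃[ i ] i Fin.< j × lookup π i ≡ suc (toℕ b)

-- The bound `x ≤ M′` keeps the head `x` from being the witness for a block `b` with `M′ ≤ toℕ b`,
-- so the witness lies in `w`. Used with `M′ = M` after an old letter and with `M′ = suc M` after a
-- new one.
hasBlocksAbove-tail : ∀ {M M′ x w k} → M ≤ M′ → x ≤ M′ →
                      HasBlocksAbove M (x ∷ w) k → HasBlocksAbove M′ w k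
hasBlocksAbove-tail {M} {M′} {x} {w} {k} M≤M′ x≤M′ (hasBlocksAbove letters used earlier) =
  hasBlocksAbove (letters ∘ suc) used′ earlier′
  where
  used′ : ∀ b → M′ ≤ toℕ b → ∃[ i ] lookup w i ≡ suc (toℕ {k} b)
  used′ b M′≤b with used b (≤-trans M≤M′ M′≤b)
  ... | zero  , refl = contradiction (≤-trans x≤M′ M′≤b) 1+n≰n
  ... | suc i , eq   = i , eq

  earlier′ : ∀ (b c : Fin k) → M′ ≤ toℕ b → b Fin.< c → ∀ j → lookup w j ≡ suc (toℕ c) →
             ∃[ i ] i Fin.< j × lookup w i ≡ suc (toℕ b)
  earlier′ b c M′≤b b<c j eq with earlier b c (≤-trans M≤M′ M′≤b) b<c (suc j) eq
  ... | zero  , _ , refl = contradiction (≤-trans x≤M′ M′≤b) 1+n≰n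
  ... | suc i , i<j , eq′ = i , s≤s⁻¹ i<j , eq′

hasBlocksAbove⇒RGF : ∀ {M k} w → HasBlocksAbove M w k → RGF M w
hasBlocksAbove⇒RGF [] h = []
hasBlocksAbove⇒RGF {M} {k} (x ∷ w) h with HasBlocksAbove.letters h zero
... | c , refl with <-cmp (toℕ c) M
... | tri< c<M _ _ = old z<s c<M (hasBlocksAbove⇒RGF w (hasBlocksAbove-tail ≤-refl c<M h))
... | tri≈ _ refl _ = new (hasBlocksAbove⇒RGF w (hasBlocksAbove-tail (n≤1+n _) ≤-refl h))
-- A first letter larger than `suc M` would skip the letter `suc M`, which `earlier` then places
-- before position zero.
... | tri> _ _ M<c = contradiction (proj₁ (proj₂ absurd)) λ ()
  where
  M<k = <-trans M<c (toℕ<n c)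
  b   = fromℕ< M<k

  absurd : ∃[ i ] i Fin.< zero {n = length w} × lookup (suc (toℕ c) ∷ w) i ≡ suc (toℕ b)
  absurd = HasBlocksAbove.earlier h b c
    (≤-reflexive (sym (toℕ-fromℕ< M<k)))
    (subst (_< toℕ c) (sym (toℕ-fromℕ< M<k)) M<c) zero refl

hasBlocksAbove-old : ∀ {M x w k} → 0 < x → x ≤ M → M ≤ k →
                     HasBlocksAbove M w k → HasBlocksAbove M (x ∷ w) k
hasBlocksAbove-old {M} {suc x} {w} {k} _ x<M M≤k (hasBlocksAbove letters used earlier) =
  hasBlocksAbove
    (λ { zero → fromℕ< (≤-trans x<M M≤k) , cong suc (sym (toℕ-fromℕ< (≤-trans x<M M≤k)))
       ; (suc i) → letters i })
    (λ b M≤b → let i , eq = used b M≤b in suc i , eq)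
    earlier′
  where
  earlier′ : ∀ (b c : Fin k) → M ≤ toℕ b → b Fin.< c → ∀ j →
             lookup (suc x ∷ w) j ≡ suc (toℕ c) →
             ∃[ i ] i Fin.< j × lookup (suc x ∷ w) i ≡ suc (toℕ b)
  earlier′ b c M≤b b<c zero refl = contradiction (≤-trans x<M M≤b) (<-asym b<c)
  earlier′ b c M≤b b<c (suc j) eq =
    let i , i<j , eq′ = earlier b c M≤b b<c j eq in suc i , s<s i<j , eq′

hasBlocksAbove-new : ∀ {M w k} → suc M ≤ k →
                     HasBlocksAbove (suc M) w k → HasBlocksAbove M (suc M ∷ w) k
hasBlocksAbove-new {M} {w} {k} M<k (hasBlocksAbove letters used earlier) =
  hasBlocksAbove
    (λ { zero → fromℕ< M<k , cong suc (sym (toℕ-fromℕ< M<k)) ; (suc i) → letters i })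
    used′ earlier′
  where
  used′ : ∀ b → M ≤ toℕ b → ∃[ i ] lookup (suc M ∷ w) i ≡ suc (toℕ {k} b)
  used′ b M≤b with m≤n⇒m<n∨m≡n M≤b
  ... | inj₁ M<b = let i , eq = used b M<b in suc i , eq
  ... | inj₂ M≡b = zero , cong suc M≡b

  earlier′ : ∀ (b c : Fin k) → M ≤ toℕ b → b Fin.< c → ∀ j →
             lookup (suc M ∷ w) j ≡ suc (toℕ c) →
             ∃[ i ] i Fin.< j × lookup (suc M ∷ w) i ≡ suc (toℕ b)
  earlier′ b c M≤b b<c zero refl = contradiction M≤b (<⇒≱ b<c)
  earlier′ b c M≤b b<c (suc j) eq with m≤n⇒m<n∨m≡n M≤b
  ... | inj₁ M<b =
    let i , i<j , eq′ = earlier b c M<b b<c j eq in suc i , s<s i<j , eq′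
  ... | inj₂ M≡b = zero , z<s , cong suc M≡b

-- The witness `k` is the number of letters introduced by the end of the word.
RGF⇒hasBlocksAbove : ∀ {M w} → RGF M w → ∃[ k ] M ≤ k × HasBlocksAbove M w k
RGF⇒hasBlocksAbove {M} [] = M , ≤-refl , hasBlocksAbove (λ ())
  (λ b M≤b → contradiction M≤b (<⇒≱ (toℕ<n b)))
  (λ b _ M≤b → contradiction M≤b (<⇒≱ (toℕ<n b)))
RGF⇒hasBlocksAbove (old 0<x x≤M r) =
  let k , M≤k , h = RGF⇒hasBlocksAbove r in k , M≤k , hasBlocksAbove-old 0<x x≤M M≤k h
RGF⇒hasBlocksAbove (new r) =
  let k , M<k , h = RGF⇒hasBlocksAbove r in k , <⇒≤ M<k , hasBlocksAbove-new M<k h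

csf⇒RGF : ∀ π → CanonicalSequentialForm π → RGF 0 π
csf⇒RGF π c = let hasBlocks letters used earlier = csf⇒hasBlocks {π} c in
  hasBlocksAbove⇒RGF π (hasBlocksAbove letters (λ b _ → used b) (λ b c _ → earlier b c))

RGF⇒csf : ∀ π → RGF 0 π → CanonicalSequentialForm π
RGF⇒csf π r = let _ , _ , hasBlocksAbove letters used earlier = RGF⇒hasBlocksAbove r in
  hasBlocks⇒csf {π} (hasBlocks letters (λ b → used b z≤n) (λ b c → earlier b c z≤n))

-- Non-crossing words as paths

-- In a canonical form the first `a` precedes the first `b` whenever `a < b`, so every `b a b`
-- extends to a crossing `a b a b`. This leaves a condition on three letters only.
Avoids212 : Word → Set
Avoids212 w = ∀ a b → a < b → ¬ (b ∷ a ∷ b ∷ [] ⊆ w)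

-- The letter `a` has not been introduced yet, as `M < a`, and restricted growth has to introduce it
-- before the larger `b`.
RGF-prepend : ∀ {M w a b v} → RGF M w → M < a → a < b → b ∷ v ⊆ w → a ∷ b ∷ v ⊆ w
RGF-prepend (old _ x≤M r) M<a a<b (skip _ sub) = skip _ (RGF-prepend r M<a a<b sub)
RGF-prepend (old _ x≤M r) M<a a<b (refl ∷ sub) =
  contradiction (<-≤-trans (<-trans M<a a<b) x≤M) (<-irrefl refl)
RGF-prepend (new r) M<a a<b (skip _ sub) with m≤n⇒m<n∨m≡n M<a
... | inj₁ 1+M<a = skip _ (RGF-prepend r 1+M<a a<b sub)
... | inj₂ refl  = refl ∷ sub
RGF-prepend (new r) M<a a<b (refl ∷ sub) = contradiction (s≤s⁻¹ a<b) (<⇒≱ M<a)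

RGF⇒0∉ : ∀ {M w} → RGF M w → ¬ (0 ∈ w)
RGF⇒0∉ (old 0<x _ r) (here refl) = contradiction 0<x λ ()
RGF⇒0∉ (old _ _ r) (there 0∈w) = RGF⇒0∉ r 0∈w
RGF⇒0∉ (new r) (there 0∈w) = RGF⇒0∉ r 0∈w

nonCrossing⇒avoids212 : ∀ {π} → RGF 0 π → NonCrossing π → Avoids212 π
nonCrossing⇒avoids212 r nc zero b a<b sub =
  RGF⇒0∉ r (Sublist.lookup sub (there (here refl)))
nonCrossing⇒avoids212 r nc (suc a) b a<b sub =
  nc (suc a) b a<b (RGF-prepend r z<s a<b sub)

avoids212⇒nonCrossing : ∀ {π} → Avoids212 π → NonCrossing π
avoids212⇒nonCrossing av a b a<b sub =
  av a b a<b (Sublist.⊆-trans (skip a Sublist.⊆-refl) sub)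

-- `top` is the letter read last, `below` lists the smaller letters that are still
-- available, and `maximum` is the number of letters introduced so far.
record State : Set where
  constructor state
  field
    top     : ℕ
    below   : List ℕ
    maximum : ℕ

open State

Step : Set
Step = Bool

-- true is U and false is F.
advance : Step → State → State
advance true  (state x s M) = state (suc M) (x ∷ s) (suc M)
advance false st            = st

-- The old top and the letters between it and `y` are closed: any later copy would form `b a b` with
-- `y` in the middle.
descend : ℕ → State → State
descend y (state x s M) = state y (filter (_<? y) s) M

data Path (st : State) : Word → Set where
  []   : Path st []
  step : ∀ b {w} → Path (advance b st) w → Path st (top (advance b st) ∷ w)
  down : ∀ {y w} → y ∈ below st → Path (descend y st) w → Path st (y ∷ w)

WellFormed : State → Set
WellFormed (state x s M) = 0 < x × x ≤ M × All (λ z → 0 < z × z < x) s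

initial : State
initial = state 1 [] 1

initial-wf : WellFormed initial
initial-wf = z<s , ≤-refl , []

advance-wf : ∀ b {st} → WellFormed st → WellFormed (advance b st)
advance-wf false wf = wf
advance-wf true (0<x , x≤M , s<x) =
  z<s , ≤-refl , (0<x , s≤s x≤M) ∷ All.map (map₂ λ z<x → <-≤-trans z<x (m≤n⇒m≤1+n x≤M)) s<x

descend-wf : ∀ {y st} → y ∈ below st → WellFormed st → WellFormed (descend y st)
descend-wf {y} {state x s M} y∈s (_ , x≤M , s<x) =
  let 0<y , y<x = All.lookup s<x y∈s in
  0<y , ≤-trans (<⇒≤ y<x) x≤M ,
  All.tabulate λ z∈ → let z∈s , z<y = ∈-filter⁻ (_<? y) z∈ in
                      proj₁ (All.lookup s<x z∈s) , z<y

path⇒RGF : ∀ {st w} → WellFormed st → Path st w → RGF (maximum st) w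
path⇒RGF wf [] = []
path⇒RGF wf (step true p) = new (path⇒RGF (advance-wf true wf) p)
path⇒RGF wf@(0<x , x≤M , _) (step false p) = old 0<x x≤M (path⇒RGF wf p)
path⇒RGF wf (down y∈s p) =
  let wf′@(0<y , y≤M , _) = descend-wf y∈s wf in old 0<y y≤M (path⇒RGF wf′ p)

Available : ℕ → State → Set
Available z st = z ≡ top st ⊎ z ∈ below st

-- Only its introduction makes a letter available, and no step restores a letter closed by a
-- descent; hence a letter introduced before must be available from the start.
path⇒available : ∀ {st w z} → Path st w → z ≤ maximum st → z ∈ w → Available z st
path⇒available (step true p) z≤M (here refl) = contradiction z≤M 1+n≰n
path⇒available (step true p) z≤M (there z∈w) with path⇒available p (m≤n⇒m≤1+n z≤M) z∈w
... | inj₁ refl         = contradiction z≤M 1+n≰n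
... | inj₂ (here eq)    = inj₁ eq
... | inj₂ (there z∈s)  = inj₂ z∈s
path⇒available (step false p) z≤M (here refl) = inj₁ refl
path⇒available (step false p) z≤M (there z∈w) = path⇒available p z≤M z∈w
path⇒available (down y∈s p) z≤M (here refl) = inj₂ y∈s
path⇒available (down {y} y∈s p) z≤M (there z∈w) with path⇒available p z≤M z∈w
... | inj₁ refl = inj₂ y∈s
... | inj₂ z∈   = inj₂ (proj₁ (∈-filter⁻ (_<? y) z∈))

-- Reading a letter makes all larger letters introduced before unavailable.
path⇒¬ascent : ∀ {st w a t} → WellFormed st → Path st w → a < t → t ≤ maximum st →
               ¬ (a ∷ t ∷ [] ⊆ w)
path⇒¬ascent wf (step true p) a<t t≤M (skip _ sub) =
  path⇒¬ascent (advance-wf true wf) p a<t (m≤n⇒m≤1+n t≤M) sub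
path⇒¬ascent wf (step true p) a<t t≤M (refl ∷ sub) =
  contradiction (<-≤-trans a<t t≤M) (<-asym (n<1+n _))
path⇒¬ascent wf (step false p) a<t t≤M (skip _ sub) = path⇒¬ascent wf p a<t t≤M sub
path⇒¬ascent wf@(_ , _ , s<x) (step false p) a<t t≤M (refl ∷ sub)
  with path⇒available p t≤M (to∈ sub)
... | inj₁ refl = <-irrefl refl a<t
... | inj₂ t∈s  = <-asym a<t (proj₂ (All.lookup s<x t∈s))
path⇒¬ascent wf (down y∈s p) a<t t≤M (skip _ sub) =
  path⇒¬ascent (descend-wf y∈s wf) p a<t t≤M sub
path⇒¬ascent {st} wf (down {y} y∈s p) a<t t≤M (refl ∷ sub)
  with path⇒available p t≤M (to∈ sub)
... | inj₁ refl = <-irrefl refl a<t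
... | inj₂ t∈   = <-asym a<t (proj₂ (∈-filter⁻ (_<? y) {xs = below st} t∈))

path⇒avoids212 : ∀ {st w} → WellFormed st → Path st w → Avoids212 w
path⇒avoids212 wf (step b p) a t a<t (skip _ sub) =
  path⇒avoids212 (advance-wf b wf) p a t a<t sub
path⇒avoids212 wf (step b p) a t a<t (refl ∷ sub) =
  path⇒¬ascent (advance-wf b wf) p a<t (proj₁ (proj₂ (advance-wf b wf))) sub
path⇒avoids212 wf (down y∈s p) a t a<t (skip _ sub) =
  path⇒avoids212 (descend-wf y∈s wf) p a t a<t sub
path⇒avoids212 wf (down y∈s p) a t a<t (refl ∷ sub) =
  path⇒¬ascent (descend-wf y∈s wf) p a<t (proj₁ (proj₂ (descend-wf y∈s wf))) sub

avoids212-tail : ∀ {x w} → Avoids212 (x ∷ w) → Avoids212 w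
avoids212-tail av a b a<b sub = av a b a<b (skip _ sub)

-- The last two hypotheses stand for the prefix already read: old letters still to come are
-- available, and no old `t` follows a smaller `a`, since with its earlier copy it would form
-- `t a t`.
RGF⇒path : ∀ {st w} → WellFormed st → RGF (maximum st) w → Avoids212 w →
           (∀ {z} → z ∈ w → z ≤ maximum st → Available z st) →
           (∀ {a t} → a < t → t ≤ maximum st → ¬ (a ∷ t ∷ [] ⊆ w)) →
           Path st w
RGF⇒path wf [] av avail ¬asc = []
RGF⇒path {st@(state x s M)} wf (new {w} r) av avail ¬asc =
  step true (RGF⇒path (advance-wf true wf) r (avoids212-tail av) avail′ ¬asc′)
  where
  avail′ : ∀ {z} → z ∈ w → z ≤ suc M → Available z (advance true st)
  avail′ z∈w z≤1+M with m≤n⇒m<n∨m≡n z≤1+M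
  ... | inj₂ z≡1+M = inj₁ z≡1+M
  ... | inj₁ z<1+M with avail (there z∈w) (s≤s⁻¹ z<1+M)
  ...   | inj₁ eq  = inj₂ (here eq)
  ...   | inj₂ z∈s = inj₂ (there z∈s)

  ¬asc′ : ∀ {a t} → a < t → t ≤ suc M → ¬ (a ∷ t ∷ [] ⊆ w)
  ¬asc′ a<t t≤1+M sub with m≤n⇒m<n∨m≡n t≤1+M
  ... | inj₁ t<1+M = ¬asc a<t (s≤s⁻¹ t<1+M) (skip _ sub)
  -- Here `t` is the letter just introduced, so the head of the word completes `t a t`.
  ... | inj₂ refl  = av _ _ a<t (refl ∷ sub)
RGF⇒path {st@(state x s M)} wf@(_ , _ , s<x) (old {y} {w} _ y≤M r) av avail ¬asc
  with avail (here refl) y≤M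
... | inj₁ refl = step false (RGF⇒path wf r (avoids212-tail av) (avail ∘ there)
                               (λ a<t t≤M sub → ¬asc a<t t≤M (skip _ sub)))
... | inj₂ y∈s = down y∈s (RGF⇒path (descend-wf y∈s wf) r (avoids212-tail av) avail′
                             (λ a<t t≤M sub → ¬asc a<t t≤M (skip _ sub)))
  where
  avail′ : ∀ {z} → z ∈ w → z ≤ M → Available z (descend y st)
  avail′ {z} z∈w z≤M with <-cmp z y
  ... | tri≈ _ z≡y _ = inj₁ z≡y
  -- An old letter larger than `y` cannot follow `y`.
  ... | tri> _ _ y<z = contradiction (refl ∷ from∈ z∈w) (¬asc y<z z≤M)
  ... | tri< z<y _ _ with avail (there z∈w) z≤M
  ...   | inj₁ refl = contradiction z<y (<-asym (proj₂ (All.lookup s<x y∈s)))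
  ...   | inj₂ z∈s  = inj₂ (∈-filter⁺ (_<? y) z∈s z<y)

path⇒nc : ∀ {w} → Path initial w →
          CanonicalSequentialForm (1 ∷ w) × NonCrossing (1 ∷ w)
path⇒nc {w} p =
  RGF⇒csf (1 ∷ w) (new (path⇒RGF initial-wf p)) , avoids212⇒nonCrossing avoids
  where
  avoids : Avoids212 (1 ∷ w)
  avoids a b a<b (skip _ sub)   = path⇒avoids212 initial-wf p a b a<b sub
  avoids a b a<b (refl ∷ sub) = path⇒¬ascent initial-wf p a<b ≤-refl sub

nc⇒path : ∀ π → π ≢ [] → CanonicalSequentialForm π → NonCrossing π →
          ∃[ w ] π ≡ 1 ∷ w × Path initial w
nc⇒path π π≢[] c nc with csf⇒RGF π c
... | [] = contradiction refl π≢[]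
... | old 0<x x≤0 _ = contradiction (<-≤-trans 0<x x≤0) λ ()
... | r@(new {w} r′) = w , refl ,
  RGF⇒path initial-wf r′ (avoids212-tail avoids) avail ¬asc
  where
  avoids : Avoids212 (1 ∷ w)
  avoids = nonCrossing⇒avoids212 r nc

  avail : ∀ {z} → z ∈ w → z ≤ 1 → Available z initial
  avail {zero}  z∈w _ = contradiction z∈w (RGF⇒0∉ r′)
  avail {suc zero} _ _ = inj₁ refl
  avail {suc (suc _)} _ (s≤s ())

  ¬asc : ∀ {a t} → a < t → t ≤ 1 → ¬ (a ∷ t ∷ [] ⊆ w)
  ¬asc {t = suc zero} a<1 _ sub = avoids _ 1 a<1 (refl ∷ sub)
  ¬asc {t = suc (suc _)} _ (s≤s ())

-- Codes

-- The U/F steps up to the first descent, then for every descent its target and the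
-- U/F steps that follow it.
Code : Set
Code = List Step × List (ℕ × List Step)

advances : State → List Step → State
advances = foldl (λ st b → advance b st)

-- Only descents are constrained, because U and F are possible in every state.
Admissible : State → List (ℕ × List Step) → Set
Admissible st []             = ⊤
Admissible st ((y , r) ∷ ds) = y ∈ below st × Admissible (advances (descend y st) r) ds

render : State → List Step → List (ℕ × List Step) → Word
render st []      []             = []
render st []      ((y , r) ∷ ds) = y ∷ render (descend y st) r ds
render st (b ∷ r) ds             = top (advance b st) ∷ render (advance b st) r ds

-- Only neighbouring letters are compared, so every word gets a code, whether or not it comes from a
-- path.
parse : ℕ → Word → Code
parse x []      = [] , []
parse x (y ∷ w) with <-cmp x y | parse y w
... | tri< _ _ _ | r , ds = true ∷ r , ds
... | tri≈ _ _ _ | r , ds = false ∷ r , ds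
... | tri> _ _ _ | r , ds = [] , (y , r) ∷ ds

-- Well-formedness puts the targets of descents below the top and new letters above it, so each
-- comparison reveals the step taken.
parse-render : ∀ {st} → WellFormed st → ∀ r ds → Admissible (advances st r) ds →
               parse (top st) (render st r ds) ≡ (r , ds)
parse-render wf [] [] _ = refl
parse-render {st} wf@(_ , _ , s<x) [] ((y , r) ∷ ds) (y∈s , adm)
  with <-cmp (top st) y | parse y (render (descend y st) r ds)
     | parse-render (descend-wf y∈s wf) r ds adm
... | tri< x<y _ _ | _ | _    = contradiction x<y (<-asym (proj₂ (All.lookup s<x y∈s)))
... | tri≈ _ x≡y _ | _ | _    = contradiction (sym x≡y) (<⇒≢ (proj₂ (All.lookup s<x y∈s)))
... | tri> _ _ _   | _ | refl = refl
parse-render {st} wf@(_ , x≤M , _) (true ∷ r) ds adm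
  with <-cmp (top st) (suc (maximum st))
     | parse (suc (maximum st)) (render (advance true st) r ds)
     | parse-render (advance-wf true wf) r ds adm
... | tri< _ _ _   | _ | refl = refl
... | tri≈ x≮1+M _ _ | _ | _  = contradiction (s≤s x≤M) x≮1+M
... | tri> x≮1+M _ _ | _ | _  = contradiction (s≤s x≤M) x≮1+M
parse-render {st} wf (false ∷ r) ds adm
  with <-cmp (top st) (top st) | parse (top st) (render st r ds) | parse-render wf r ds adm
... | tri< _ x≢x _ | _ | _    = contradiction refl x≢x
... | tri≈ _ _ _   | _ | refl = refl
... | tri> _ x≢x _ | _ | _    = contradiction refl x≢x

path⇒code : ∀ {st w} → Path st w →
            ∃₂ λ r ds → Admissible (advances st r) ds × render st r ds ≡ w
path⇒code []         = [] , [] , tt , refl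
path⇒code (step b p) = let r , ds , adm , eq = path⇒code p in
  b ∷ r , ds , adm , cong (_ ∷_) eq
path⇒code (down y∈s p) = let r , ds , adm , eq = path⇒code p in
  [] , (_ , r) ∷ ds , (y∈s , adm) , cong (_ ∷_) eq

code⇒path : ∀ {st} r ds → Admissible (advances st r) ds → Path st (render st r ds)
code⇒path []      []             _           = []
code⇒path []      ((y , r) ∷ ds) (y∈s , adm) = down y∈s (code⇒path r ds adm)
code⇒path (b ∷ r) ds             adm         = step b (code⇒path r ds adm)

-- Reversal of the blocks of a code

flips : List (ℕ × List Step) → List (ℕ × List Step)
flips = map (map₂ reverse)

flips-involutive : ∀ ds → flips (flips ds) ≡ ds
flips-involutive []             = refl
flips-involutive ((y , r) ∷ ds) =
  cong₂ _∷_ (cong (y ,_) (reverse-involutive r)) (flips-involutive ds)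

advance-comm : ∀ b c st → advance b (advance c st) ≡ advance c (advance b st)
advance-comm true  true  st = refl
advance-comm true  false st = refl
advance-comm false c     st = refl

advances-comm : ∀ b r st → advances (advance b st) r ≡ advance b (advances st r)
advances-comm b []      st = refl
advances-comm b (c ∷ r) st =
  trans (cong (λ st′ → advances st′ r) (advance-comm c b st)) (advances-comm b r (advance c st))

-- Any two steps commute, so a block reaches the same state in either order. This keeps the targets
-- of later descents available.
advances-reverse : ∀ r st → advances st (reverse r) ≡ advances st r
advances-reverse []      st = refl
advances-reverse (b ∷ r) st = begin
  advances st (reverse (b ∷ r))       ≡⟨ cong (advances st) (unfold-reverse b r) ⟩
  advances st (reverse r List.∷ʳ b)   ≡⟨ foldl-∷ʳ _ st b (reverse r) ⟩
  advance b (advances st (reverse r)) ≡⟨ cong (advance b) (advances-reverse r st) ⟩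
  advance b (advances st r)           ≡⟨ advances-comm b r st ⟨
  advances (advance b st) r           ∎
  where open ≡-Reasoning

admissible-flips : ∀ {st} ds → Admissible st ds → Admissible st (flips ds)
admissible-flips []             _           = tt
admissible-flips {st} ((y , r) ∷ ds) (y∈s , adm) =
  y∈s , subst (λ st′ → Admissible st′ (flips ds)) (sym (advances-reverse r (descend y st)))
              (admissible-flips ds adm)

admissible-reverse : ∀ {st} r ds → Admissible (advances st r) ds →
                     Admissible (advances st (reverse r)) (flips ds)
admissible-reverse {st} r ds adm =
  subst (λ st′ → Admissible st′ (flips ds)) (sym (advances-reverse r st))
        (admissible-flips ds adm)

size : List Step → List (ℕ × List Step) → ℕ
size r []              = length r
size r ((y , r′) ∷ ds) = length r + suc (size r′ ds)

length-render : ∀ st r ds → length (render st r ds) ≡ size r ds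
length-render st [] []             = refl
length-render st [] ((y , r) ∷ ds) = cong suc (length-render (descend y st) r ds)
length-render st (b ∷ r) []        = cong suc (length-render (advance b st) r [])
length-render st (b ∷ r) (d ∷ ds)  = cong suc (length-render (advance b st) r (d ∷ ds))

size-reverse : ∀ r ds → size (reverse r) (flips ds) ≡ size r ds
size-reverse r []              = length-reverse r
size-reverse r ((y , r′) ∷ ds) =
  cong₂ (λ i j → i + suc j) (length-reverse r) (size-reverse r′ ds)

length-render-reverse : ∀ st r ds →
  length (render st (reverse r) (flips ds)) ≡ length (render st r ds)
length-render-reverse st r ds =
  trans (length-render st (reverse r) (flips ds))
        (trans (size-reverse r ds) (sym (length-render st r ds)))

-- Factors of step sequences

indicator : ∀ {A : Set} → Dec A → ℕ
indicator A? = if does A? then 1 else 0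

indicator-cong : ∀ {A B : Set} (A? : Dec A) (B? : Dec B) → A ⇔ B →
                 indicator A? ≡ indicator B?
indicator-cong (yes a) (yes b) e = refl
indicator-cong (no ¬a) (no ¬b) e = refl
indicator-cong (yes a) (no ¬b) e = contradiction (to e a) ¬b
indicator-cong (no ¬a) (yes b) e = contradiction (from e b) ¬a

equals : List Step → List Step → ℕ
equals P r = indicator (≡-dec Boolₚ._≟_ P r)

equals-reverse : ∀ P r → equals (reverse P) (reverse r) ≡ equals P r
equals-reverse P r = indicator-cong
  (≡-dec Boolₚ._≟_ (reverse P) (reverse r)) (≡-dec Boolₚ._≟_ P r)
  (mk⇔ reverse-injective (cong reverse))

-- Valued in 0 and 1 rather than in `Bool`, so that `factors` can add these values.
isPrefix : List Step → List Step → ℕ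
isPrefix []      r       = 1
isPrefix (p ∷ P) []      = 0
isPrefix (p ∷ P) (b ∷ r) = if does (p Boolₚ.≟ b) then isPrefix P r else 0

-- An appended step creates a new prefix only when `P` is the whole extended sequence.
isPrefix-∷ʳ : ∀ P r b → isPrefix P (r List.∷ʳ b) ≡ isPrefix P r + equals P (r List.∷ʳ b)
isPrefix-∷ʳ [] []      b = refl
isPrefix-∷ʳ [] (c ∷ r) b = refl
isPrefix-∷ʳ (p ∷ P) [] b with p Boolₚ.≟ b
... | no  _ = refl
... | yes _ with P
...   | []    = refl
...   | _ ∷ _ = refl
isPrefix-∷ʳ (p ∷ P) (c ∷ r) b with p Boolₚ.≟ c
... | no  _ = refl
... | yes _ = isPrefix-∷ʳ P r b

isPrefix-reverse-[] : ∀ P → isPrefix (reverse P) [] ≡ isPrefix P []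
isPrefix-reverse-[] []      = refl
isPrefix-reverse-[] (p ∷ P) rewrite unfold-reverse p P with reverse P
... | []    = refl
... | _ ∷ _ = refl

-- The empty suffix counts as a starting position too. It stands for the last letter of a block, as
-- `length r` steps join `suc (length r)` letters.
factors : List Step → List Step → ℕ
factors P []      = isPrefix P []
factors P (b ∷ r) = isPrefix P (b ∷ r) + factors P r

-- The new factors are those ending at `b`; read backwards they are prefixes of the reversed
-- sequence. In the induction, an occurrence filling the whole sequence is the one term that moves
-- from the prefix count to the count of factors ending at `b`.
factors-∷ʳ : ∀ P r b → factors P (r List.∷ʳ b) ≡
                       factors P r + isPrefix (reverse P) (reverse (r List.∷ʳ b))
factors-∷ʳ P [] b = begin
  isPrefix P (b ∷ []) + e
    ≡⟨ cong (_+ e) (isPrefix-∷ʳ P [] b) ⟩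
  (e + equals P (b ∷ [])) + e
    ≡⟨ +-comm _ e ⟩
  e + (e + equals P (b ∷ []))
    ≡⟨ cong (e +_) (cong₂ _+_ (isPrefix-reverse-[] P) (equals-reverse P (b ∷ []))) ⟨
  e + (isPrefix (reverse P) [] + equals (reverse P) (b ∷ []))
    ≡⟨ cong (e +_) (isPrefix-∷ʳ (reverse P) [] b) ⟨
  e + isPrefix (reverse P) (b ∷ []) ∎
  where
  open ≡-Reasoning
  e = isPrefix P []
factors-∷ʳ P (c ∷ r) b = begin
  isPrefix P (c ∷ rb) + factors P rb
    ≡⟨ cong₂ _+_ (isPrefix-∷ʳ P (c ∷ r) b) (factors-∷ʳ P r b) ⟩
  (p + equals P (c ∷ rb)) + (factors P r + q)
    ≡⟨ +-assoc p _ _ ⟩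
  p + (equals P (c ∷ rb) + (factors P r + q))
    ≡⟨ cong (p +_) (+-comm _ (factors P r + q)) ⟩
  p + ((factors P r + q) + equals P (c ∷ rb))
    ≡⟨ cong (p +_) (+-assoc (factors P r) q _) ⟩
  p + (factors P r + (q + equals P (c ∷ rb)))
    ≡⟨ +-assoc p (factors P r) _ ⟨
  (p + factors P r) + (q + equals P (c ∷ rb))
    ≡⟨ cong (λ e → (p + factors P r) + (q + e)) (equals-reverse P (c ∷ rb)) ⟨
  (p + factors P r) + (q + equals (reverse P) (reverse (c ∷ rb)))
    ≡⟨ cong (λ v → (p + factors P r) + (q + equals (reverse P) v)) (unfold-reverse c rb) ⟩
  (p + factors P r) + (q + equals (reverse P) (reverse rb List.∷ʳ c))
    ≡⟨ cong ((p + factors P r) +_) (isPrefix-∷ʳ (reverse P) (reverse rb) c) ⟨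
  (p + factors P r) + isPrefix (reverse P) (reverse rb List.∷ʳ c)
    ≡⟨ cong (λ v → (p + factors P r) + isPrefix (reverse P) v) (unfold-reverse c rb) ⟨
  (p + factors P r) + isPrefix (reverse P) (reverse (c ∷ rb)) ∎
  where
  open ≡-Reasoning
  rb = r List.∷ʳ b
  p  = isPrefix P (c ∷ r)
  q  = isPrefix (reverse P) (reverse rb)

-- The first step of a sequence is the last step of its reversal, so `factors-∷ʳ` for `reverse P`
-- supplies exactly the prefix term.
factors-reverse : ∀ P r → factors (reverse P) (reverse r) ≡ factors P r
factors-reverse P []      = isPrefix-reverse-[] P
factors-reverse P (b ∷ r) = begin
  factors (reverse P) (reverse (b ∷ r))
    ≡⟨ cong (factors (reverse P)) (unfold-reverse b r) ⟩
  factors (reverse P) (reverse r List.∷ʳ b)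
    ≡⟨ factors-∷ʳ (reverse P) (reverse r) b ⟩
  factors (reverse P) (reverse r) +
  isPrefix (reverse (reverse P)) (reverse (reverse r List.∷ʳ b))
    ≡⟨ cong₂ _+_ (factors-reverse P r)
         (cong₂ isPrefix (reverse-involutive P)
           (trans (cong reverse (sym (unfold-reverse b r))) (reverse-involutive (b ∷ r)))) ⟩
  factors P r + isPrefix P (b ∷ r)
    ≡⟨ +-comm (factors P r) _ ⟩
  isPrefix P (b ∷ r) + factors P r ∎
  where open ≡-Reasoning

codeFactors : List Step → List Step → List (ℕ × List Step) → ℕ
codeFactors P r []              = factors P r
codeFactors P r ((y , r′) ∷ ds) = factors P r + codeFactors P r′ ds

codeFactors-reverse : ∀ P r ds →
  codeFactors (reverse P) (reverse r) (flips ds) ≡ codeFactors P r ds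
codeFactors-reverse P r []              = factors-reverse P r
codeFactors-reverse P r ((y , r′) ∷ ds) =
  cong₂ _+_ (factors-reverse P r) (codeFactors-reverse P r′ ds)

-- Occurrences as factors

raise : Step → ℕ → ℕ
raise true  v = suc v
raise false v = v

rises : ℕ → List Step → Word
rises v []      = []
rises v (b ∷ P) = raise b v ∷ rises (raise b v) P

-- The pattern whose neighbouring letters rise by one or repeat as `P` prescribes. Both patterns of
-- the theorem have this form, with step sequences that are reversals of each other.
shape : ℕ → List Step → Word
shape v P = v ∷ rises v P

Compare : Step → ℕ → ℕ → Set
Compare true  = _<_
Compare false = _≡_

-- A rise may skip letters, as order isomorphism only sees that the next letter is larger.
Climbs : List Step → ℕ → Word → Set
Climbs []      x w       = ⊤
Climbs (b ∷ P) x []      = ⊥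
Climbs (b ∷ P) x (y ∷ w) = Compare b x y × Climbs P y w

-- Any decision of `Climbs P x w` is allowed. Since `map′` preserves the truth value, the recursive
-- call can receive a decision for the tail, and one obtained from `occursAt?` can be supplied
-- later.
isPrefix-parse : ∀ P x w (climbs? : Dec (Climbs P x w)) →
                 isPrefix P (proj₁ (parse x w)) ≡ indicator climbs?
isPrefix-parse [] x w (yes _) = refl
isPrefix-parse [] x w (no ¬c) = contradiction tt ¬c
isPrefix-parse (p ∷ P) x [] (no _) = refl
isPrefix-parse (p ∷ P) x (y ∷ w) climbs?
  with <-cmp x y | parse y w | isPrefix-parse P y w
isPrefix-parse (true ∷ P) x (y ∷ w) climbs? | tri< x<y _ _ | _ | ih =
  ih (map′ proj₂ (x<y ,_) climbs?)
isPrefix-parse (true ∷ P) x (y ∷ w) (yes (x<y , _)) | tri≈ x≮y _ _ | _ | ih =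
  contradiction x<y x≮y
isPrefix-parse (true ∷ P) x (y ∷ w) (no _) | tri≈ x≮y _ _ | _ | ih = refl
isPrefix-parse (true ∷ P) x (y ∷ w) (yes (x<y , _)) | tri> x≮y _ _ | _ | ih =
  contradiction x<y x≮y
isPrefix-parse (true ∷ P) x (y ∷ w) (no _) | tri> x≮y _ _ | _ | ih = refl
isPrefix-parse (false ∷ P) x (y ∷ w) climbs? | tri≈ _ x≡y _ | _ | ih =
  ih (map′ proj₂ (x≡y ,_) climbs?)
isPrefix-parse (false ∷ P) x (y ∷ w) (yes (x≡y , _)) | tri< _ x≢y _ | _ | ih =
  contradiction x≡y x≢y
isPrefix-parse (false ∷ P) x (y ∷ w) (no _) | tri< _ x≢y _ | _ | ih = refl
isPrefix-parse (false ∷ P) x (y ∷ w) (yes (x≡y , _)) | tri> _ x≢y _ | _ | ih =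
  contradiction x≡y x≢y
isPrefix-parse (false ∷ P) x (y ∷ w) (no _) | tri> _ x≢y _ | _ | ih = refl

rises-≥ : ∀ v P → All (v ≤_) (rises v P)
rises-≥ v []          = []
rises-≥ v (true  ∷ P) = n≤1+n v ∷ All.map (≤-trans (n≤1+n v)) (rises-≥ (suc v) P)
rises-≥ v (false ∷ P) = ≤-refl ∷ rises-≥ v P

orderIsomorphic-tail : ∀ {x p u v} → OrderIsomorphic (x ∷ u) (p ∷ v) → OrderIsomorphic u v
orderIsomorphic-tail (e , iso) = suc-injective e , λ s t → iso (suc s) (suc t)

orderIsomorphic-repeat : ∀ {y q u v} → OrderIsomorphic (y ∷ u) (q ∷ v) →
                         OrderIsomorphic (y ∷ y ∷ u) (q ∷ q ∷ v)
orderIsomorphic-repeat (e , iso) = cong suc e , λ where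
  zero    zero    → iso zero zero
  zero    (suc t) → iso zero t
  (suc s) zero    → iso s zero
  (suc s) (suc t) → iso s t

-- As `q` is least in `q ∷ v`, the isomorphism makes `y` least in `y ∷ u`. Hence `x` lies below all
-- of `y ∷ u`, just as `p` lies below all of `q ∷ v`.
orderIsomorphic-below : ∀ {x p y q u v} → x < y → p < q → All (q ≤_) v →
                        OrderIsomorphic (y ∷ u) (q ∷ v) →
                        OrderIsomorphic (x ∷ y ∷ u) (p ∷ q ∷ v)
orderIsomorphic-below {x} {p} {y} {q} {u} {v} x<y p<q q≤v (e , iso) = cong suc e , λ where
    zero    zero    → mk⇔ (λ x<x → contradiction refl (<⇒≢ x<x))
                          (λ p<p → contradiction refl (<⇒≢ p<p))
                    , mk⇔ (λ _ → refl) (λ _ → refl)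
    zero    (suc t) → mk⇔ (λ _ → p<v t) (λ _ → x<u t)
                    , mk⇔ (λ x≡ → contradiction x≡ (<⇒≢ (x<u t)))
                          (λ p≡ → contradiction p≡ (<⇒≢ (p<v t)))
    (suc s) zero    → mk⇔ (λ <x → contradiction <x (<-asym (x<u s)))
                          (λ <p → contradiction <p (<-asym (p<v s)))
                    , mk⇔ (λ ≡x → contradiction (sym ≡x) (<⇒≢ (x<u s)))
                          (λ ≡p → contradiction (sym ≡p) (<⇒≢ (p<v s)))
    (suc s) (suc t) → iso s t
  where
  q≤ : ∀ t → q ≤ lookup (q ∷ v) t
  q≤ t = All.lookup (≤-refl ∷ q≤v) (∈-lookup {xs = q ∷ v} t)

  p<v : ∀ t → p < lookup (q ∷ v) (cast e t)
  p<v t = <-≤-trans p<q (q≤ (cast e t))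

  x<u : ∀ t → x < lookup (y ∷ u) t
  x<u t = <-≤-trans x<y (≮⇒≥ λ u<y →
    contradiction (to (proj₁ (iso t zero)) u<y) (≤⇒≯ (q≤ (cast e t))))

-- A shape is weakly increasing, so its order type is determined by the comparisons of neighbours.
occursAt-0⇔climbs : ∀ P v x w → OccursAt (shape v P) (x ∷ w) 0 ⇔ Climbs P x w
occursAt-0⇔climbs P v x w = mk⇔ (climbs P v x w) (occurs P v x w)
  where
  climbs : ∀ P v x w → OccursAt (shape v P) (x ∷ w) 0 → Climbs P x w
  climbs []          v x w       o         = tt
  climbs (b ∷ P)     v x []      (() , _)
  climbs (true ∷ P)  v x (y ∷ w) o@(_ , iso) =
    from (proj₁ (iso zero (suc zero))) ≤-refl ,
    climbs P (suc v) y w (orderIsomorphic-tail o)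
  climbs (false ∷ P) v x (y ∷ w) o@(_ , iso) =
    from (proj₂ (iso zero (suc zero))) refl ,
    climbs P v y w (orderIsomorphic-tail o)

  occurs : ∀ P v x w → Climbs P x w → OccursAt (shape v P) (x ∷ w) 0
  occurs [] v x w _ = refl , λ where
    zero zero → mk⇔ (λ x<x → contradiction refl (<⇒≢ x<x))
                    (λ v<v → contradiction refl (<⇒≢ v<v))
              , mk⇔ (λ _ → refl) (λ _ → refl)
  occurs (true ∷ P) v x (y ∷ w) (x<y , c) =
    orderIsomorphic-below x<y ≤-refl (rises-≥ (suc v) P) (occurs P (suc v) y w c)
  occurs (false ∷ P) v x (y ∷ w) (refl , c) =
    orderIsomorphic-repeat (occurs P v y w c)

-- Occurrences counted by recursion on the word

length-filter-map : ∀ {A B : Set} {Q : B → Set} (Q? : Decidable Q) (f : A → B) xs →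
                    length (filter Q? (map f xs)) ≡ length (filter (λ x → Q? (f x)) xs)
length-filter-map Q? f [] = refl
length-filter-map Q? f (x ∷ xs) with does (Q? (f x))
... | true  = cong suc (length-filter-map Q? f xs)
... | false = length-filter-map Q? f xs

length-filter-∷ : ∀ {A : Set} {Q : A → Set} (Q? : Decidable Q) x xs →
                  length (filter Q? (x ∷ xs)) ≡ indicator (Q? x) + length (filter Q? xs)
length-filter-∷ Q? x xs with does (Q? x)
... | true  = refl
... | false = refl

occurrences-[] : ∀ p τ → occurrences (p ∷ τ) [] ≡ 0
occurrences-[] p τ =
  cong (λ N → length (filter (occursAt? (p ∷ τ) []) (upTo N))) (0∸n≡0 (length τ))

occurrences-∷ : ∀ p τ x w → occurrences (p ∷ τ) (x ∷ w) ≡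
                indicator (occursAt? (p ∷ τ) (x ∷ w) 0) + occurrences (p ∷ τ) w
occurrences-∷ p τ x w with length τ ≤? length w
... | yes τ≤w = begin
  length (filter occ? (upTo (suc (length w) ∸ length τ)))
    ≡⟨ cong (λ N → length (filter occ? (upTo N))) (+-∸-assoc 1 τ≤w) ⟩
  length (filter occ? (0 ∷ applyUpTo suc N))
    ≡⟨ length-filter-∷ occ? 0 (applyUpTo suc N) ⟩
  indicator (occ? 0) + length (filter occ? (applyUpTo suc N))
    ≡⟨ cong (λ is → indicator (occ? 0) + length (filter occ? is)) (map-upTo suc N) ⟨
  indicator (occ? 0) + length (filter occ? (map suc (upTo N)))
    -- Dropping `suc i` letters of `x ∷ w` amounts to dropping `i` letters of `w`, so the shifted
    -- filter is the one for `w`.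
    ≡⟨ cong (indicator (occ? 0) +_) (length-filter-map occ? suc (upTo N)) ⟩
  indicator (occ? 0) + occurrences (p ∷ τ) w ∎
  where
  open ≡-Reasoning
  N = length w ∸ length τ
  occ? = occursAt? (p ∷ τ) (x ∷ w)
-- The pattern is longer than `x ∷ w`: truncated subtraction leaves no starting position in either
-- word, and position 0 is no occurrence.
... | no τ≰w = begin
  length (filter occ? (upTo (suc (length w) ∸ length τ)))
    ≡⟨ cong (λ N → length (filter occ? (upTo N))) (m≤n⇒m∸n≡0 w<τ) ⟩
  0
    ≡⟨ cong₂ _+_ ¬occ
         (cong (λ N → length (filter (occursAt? (p ∷ τ) w) (upTo N))) (m≤n⇒m∸n≡0 (<⇒≤ w<τ))) ⟨
  indicator (occ? 0) + occurrences (p ∷ τ) w ∎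
  where
  open ≡-Reasoning
  w<τ = ≰⇒> τ≰w
  occ? = occursAt? (p ∷ τ) (x ∷ w)

  too-short : ¬ OccursAt (p ∷ τ) (x ∷ w) 0
  too-short (e , _) = <⇒≱ w<τ (subst (_≤ length w) τ≡ (m⊓n≤n (length τ) (length w)))
    where
    τ≡ = trans (sym (length-take (length τ) w)) (suc-injective e)

  ¬occ : indicator (occ? 0) ≡ 0
  ¬occ = indicator-cong (occ? 0) (no id) (mk⇔ too-short λ ())

-- An occurrence at the head is a prefix of the steps before the next descent, since a shape never
-- descends; the other occurrences lie in `w`.
occurrences-shape : ∀ P v x w →
  occurrences (shape v P) (x ∷ w) ≡ (let r , ds = parse x w in codeFactors P r ds)
occurrences-shape P v x w = begin
  occurrences (shape v P) (x ∷ w)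
    ≡⟨ occurrences-∷ v (rises v P) x w ⟩
  indicator (occursAt? (shape v P) (x ∷ w) 0) + occurrences (shape v P) w
    ≡⟨ cong (_+ occurrences (shape v P) w) head-factor ⟨
  isPrefix P (proj₁ (parse x w)) + occurrences (shape v P) w
    ≡⟨ tail-factors w ⟩
  (let r , ds = parse x w in codeFactors P r ds) ∎
  where
  open ≡-Reasoning

  head-factor : isPrefix P (proj₁ (parse x w)) ≡
                indicator (occursAt? (shape v P) (x ∷ w) 0)
  head-factor =
    isPrefix-parse P x w (map′ (to iff) (from iff) (occursAt? (shape v P) (x ∷ w) 0))
    where iff = occursAt-0⇔climbs P v x w

  tail-factors : ∀ w → isPrefix P (proj₁ (parse x w)) + occurrences (shape v P) w ≡
                 (let r , ds = parse x w in codeFactors P r ds)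
  tail-factors [] = trans (cong (isPrefix P [] +_) (occurrences-[] v (rises v P))) (+-identityʳ _)
  tail-factors (y ∷ w) with <-cmp x y | parse y w | occurrences-shape P v y w
  ... | tri< _ _ _ | r , []     | eq = cong (isPrefix P (true ∷ r) +_) eq
  ... | tri< _ _ _ | r , d ∷ ds | eq =
    trans (cong (isPrefix P (true ∷ r) +_) eq) (sym (+-assoc (isPrefix P (true ∷ r)) _ _))
  ... | tri≈ _ _ _ | r , []     | eq = cong (isPrefix P (false ∷ r) +_) eq
  ... | tri≈ _ _ _ | r , d ∷ ds | eq =
    trans (cong (isPrefix P (false ∷ r) +_) eq) (sym (+-assoc (isPrefix P (false ∷ r)) _ _))
  -- A descent right after `x` leaves it with an empty block, whose only term is `factors P []`.
  ... | tri> _ _ _ | r , ds     | eq = cong (isPrefix P [] +_) eq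

-- The involution

-- A relation rather than a function on words: a pair carries a code and its admissibility, and
-- other words need no image.
data Flipped : Word → Word → Set where
  empty : Flipped [] []
  coded : ∀ r ds → Admissible (advances initial r) ds →
          Flipped (1 ∷ render initial r ds) (1 ∷ render initial (reverse r) (flips ds))

NonCrossingForm : Word → Set
NonCrossingForm π = CanonicalSequentialForm π × NonCrossing π

flipped-exists : ∀ π → NonCrossingForm π → ∃[ ρ ] Flipped π ρ
flipped-exists [] _ = [] , empty
flipped-exists (x ∷ w) (c , nc) with nc⇒path (x ∷ w) (λ ()) c nc
... | w , refl , p with path⇒code p
...   | r , ds , adm , refl = _ , coded r ds adm

flipped-length : ∀ {π ρ} → Flipped π ρ → length ρ ≡ length π
flipped-length empty            = refl
flipped-length (coded r ds adm) = cong suc (length-render-reverse initial r ds)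

flipped-nc : ∀ {π ρ} → Flipped π ρ → NonCrossingForm π → NonCrossingForm ρ
flipped-nc empty            nc = nc
flipped-nc (coded r ds adm) _  =
  path⇒nc (code⇒path (reverse r) (flips ds) (admissible-reverse r ds adm))

render-injective : ∀ r ds r′ ds′ → Admissible (advances initial r) ds →
                   Admissible (advances initial r′) ds′ →
                   render initial r ds ≡ render initial r′ ds′ → (r , ds) ≡ (r′ , ds′)
render-injective r ds r′ ds′ adm adm′ eq =
  trans (sym (parse-render initial-wf r ds adm))
        (trans (cong (parse 1) eq) (parse-render initial-wf r′ ds′ adm′))

-- The flipped word determines its code, and flipping that code again restores the original one.
flipped-injective : ∀ {π π′ ρ ρ′} → Flipped π ρ → Flipped π′ ρ′ → ρ ≡ ρ′ → π ≡ π′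
flipped-injective empty empty _ = refl
flipped-injective (coded r ds adm) (coded r′ ds′ adm′) eq =
  cong (λ (r , ds) → 1 ∷ render initial r ds)
    (trans (sym (unflip r ds)) (trans (cong flip codes≡) (unflip r′ ds′)))
  where
  flip : Code → Code
  flip (r , ds) = reverse r , flips ds

  unflip : ∀ r ds → flip (flip (r , ds)) ≡ (r , ds)
  unflip r ds = cong₂ _,_ (reverse-involutive r) (flips-involutive ds)

  codes≡ : flip (r , ds) ≡ flip (r′ , ds′)
  codes≡ = render-injective _ _ _ _ (admissible-reverse r ds adm)
             (admissible-reverse r′ ds′ adm′) (∷-injectiveʳ eq)

flipped-occurrences : ∀ P v {π ρ} → Flipped π ρ →
                      occurrences (shape v (reverse P)) ρ ≡ occurrences (shape v P) π
flipped-occurrences P v empty =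
  trans (occurrences-[] v (rises v (reverse P))) (sym (occurrences-[] v (rises v P)))
flipped-occurrences P v (coded r ds adm) = begin
  occurrences (shape v (reverse P)) (1 ∷ render initial (reverse r) (flips ds))
    ≡⟨ occurrences-code (reverse P) (reverse r) (flips ds) (admissible-reverse r ds adm) ⟩
  codeFactors (reverse P) (reverse r) (flips ds)
    ≡⟨ codeFactors-reverse P r ds ⟩
  codeFactors P r ds
    ≡⟨ occurrences-code P r ds adm ⟨
  occurrences (shape v P) (1 ∷ render initial r ds) ∎
  where
  open ≡-Reasoning
  occurrences-code : ∀ P r ds → Admissible (advances initial r) ds →
    occurrences (shape v P) (1 ∷ render initial r ds) ≡ codeFactors P r ds
  occurrences-code P r ds adm = trans (occurrences-shape P v 1 (render initial r ds))
    (cong (λ (r , ds) → codeFactors P r ds) (parse-render initial-wf r ds adm))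

-- Counting

-- Pigeonhole: the `y` matched with the head is deleted from `ys`, and injectivity together with
-- uniqueness keeps the rest of `xs` from using it.
length-≤ : ∀ {A : Set} {R : A → A → Set} →
           (∀ {x x′ y y′} → R x y → R x′ y′ → y ≡ y′ → x ≡ x′) →
           ∀ {xs} → Unique xs → ∀ ys → (∀ {x} → x ∈ xs → ∃[ y ] y ∈ ys × R x y) →
           length xs ≤ length ys
length-≤ R-injective [] ys total = z≤n
length-≤ {R = R} R-injective {x ∷ xs} (x∉xs ∷ xs!) ys total
  with y , y∈ys , Rxy ← total (here refl)
  with as , bs , refl ← ∈-∃++ y∈ys =
  subst (suc (length xs) ≤_) (sym (length-++-sucʳ as y bs))
        (s≤s (length-≤ R-injective xs! (as ++ bs) total′))
  where
  total′ : ∀ {x′} → x′ ∈ xs → ∃[ y′ ] y′ ∈ as ++ bs × R x′ y′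
  total′ x′∈xs with total (there x′∈xs)
  ... | y′ , y′∈ , Rx′y′ with ∈-++⁻ as y′∈
  ...   | inj₁ y′∈as         = y′ , ∈-++⁺ˡ y′∈as , Rx′y′
  ...   | inj₂ (there y′∈bs) = y′ , ∈-++⁺ʳ as y′∈bs , Rx′y′
  ...   | inj₂ (here y′≡y)   =
    contradiction (R-injective Rxy Rx′y′ (sym y′≡y)) (All.lookup x∉xs x′∈xs)

countNC-≤ : ∀ P v n k → countNC (shape v P) n k ≤ countNC (shape v (reverse P)) n k
countNC-≤ P v n k =
  length-≤ flipped-injective (Uniqueₚ.filter⁺ occ? (NC-unique n)) _ total
  where
  occ? : Decidable (λ π → occurrences (shape v P) π ≡ k)
  occ? π = occurrences (shape v P) π ≟ k

  occʳ? : Decidable (λ π → occurrences (shape v (reverse P)) π ≡ k)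
  occʳ? π = occurrences (shape v (reverse P)) π ≟ k

  total : ∀ {π} → π ∈ filter occ? (NC n) → ∃[ ρ ] ρ ∈ filter occʳ? (NC n) × Flipped π ρ
  total {π} π∈ =
    let π∈NC , occ≡k = ∈-filter⁻ occ? π∈
        len , nc     = to (∈-NC n π) π∈NC
        ρ , fl       = flipped-exists π nc
    in ρ , ∈-filter⁺ occʳ?
             (from (∈-NC n ρ) (trans (flipped-length fl) len , flipped-nc fl nc))
             (trans (flipped-occurrences P v fl) occ≡k) , fl

-- One inequality suffices: applied to `reverse P` it gives the converse, as reversing twice
-- restores `P`.
shape-reverse : ∀ P v → shape v P ≡ₛ shape v (reverse P)
shape-reverse P v n k = ≤-antisym (countNC-≤ P v n k)
  (subst (λ Q → countNC (shape v (reverse P)) n k ≤ countNC (shape v Q) n k)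
         (reverse-involutive P) (countNC-≤ (reverse P) v n k))

-- The two patterns as shapes

reverse-replicate : ∀ {A : Set} n (x : A) → reverse (replicate n x) ≡ replicate n x
reverse-replicate zero    x = refl
reverse-replicate (suc n) x = begin
  reverse (x ∷ replicate n x)       ≡⟨ unfold-reverse x (replicate n x) ⟩
  reverse (replicate n x) List.∷ʳ x ≡⟨ cong (List._∷ʳ x) (reverse-replicate n x) ⟩
  replicate n x List.∷ʳ x           ≡⟨ replicate-∷ʳ n x ⟩
  x ∷ replicate n x                 ∎
  where
  open ≡-Reasoning
  replicate-∷ʳ : ∀ {A : Set} n (x : A) → replicate n x List.∷ʳ x ≡ x ∷ replicate n x
  replicate-∷ʳ zero    x = refl
  replicate-∷ʳ (suc n) x = cong (x ∷_) (replicate-∷ʳ n x)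

applyUpTo-cong : ∀ {A : Set} {f g : ℕ → A} → (∀ i → f i ≡ g i) → ∀ n →
                 applyUpTo f n ≡ applyUpTo g n
applyUpTo-cong f≗g zero    = refl
applyUpTo-cong f≗g (suc n) = cong₂ _∷_ (f≗g 0) (applyUpTo-cong (f≗g ∘ suc) n)

rises-ups : ∀ v n → rises v (replicate n true) ≡ applyUpTo (λ i → suc v + i) n
rises-ups v zero    = refl
rises-ups v (suc n) = cong₂ _∷_ (sym (+-identityʳ (suc v)))
  (trans (rises-ups (suc v) n) (applyUpTo-cong (λ i → cong suc (sym (+-suc v i))) n))

rises-flats : ∀ v n → rises v (replicate n false) ≡ replicate n v
rises-flats v zero    = refl
rises-flats v (suc n) = cong (v ∷_) (rises-flats v n)

rises-flats-++ : ∀ v n P → rises v (replicate n false ++ P) ≡ replicate n v ++ rises v P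
rises-flats-++ v zero    P = refl
rises-flats-++ v (suc n) P = cong (v ∷_) (rises-flats-++ v n P)

-- The letter `v + n` reached by the rises is already the head of the remaining shape, so the prefix
-- stops one letter earlier.
shape-ups-++ : ∀ v n P → shape v (replicate n true ++ P) ≡
               applyUpTo (v +_) n ++ shape (v + n) P
shape-ups-++ v zero    P = cong (λ v → shape v P) (sym (+-identityʳ v))
shape-ups-++ v (suc n) P = cong₂ _∷_ (sym (+-identityʳ v)) (begin
  shape (suc v) (replicate n true ++ P)
    ≡⟨ shape-ups-++ (suc v) n P ⟩
  applyUpTo (suc v +_) n ++ shape (suc v + n) P
    ≡⟨ cong₂ (λ us u → us ++ shape u P)
         (applyUpTo-cong (λ i → sym (+-suc v i)) n) (sym (+-suc v n)) ⟩
  applyUpTo (λ i → v + suc i) n ++ shape (v + suc n) P ∎)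
  where open ≡-Reasoning

-- A run of `suc a` equal letters takes `a` repetitions, and `suc m` distinct letters take `m`
-- rises.
pattern₁-shape : ∀ a m → pattern₁ (suc a) (suc m) ≡
                 shape 1 (replicate a false ++ replicate m true)
pattern₁-shape a m = cong (1 ∷_) (begin
  replicate a 1 ++ map (2 +_) (upTo m)       ≡⟨ cong (replicate a 1 ++_) (map-upTo (2 +_) m) ⟩
  replicate a 1 ++ applyUpTo (2 +_) m        ≡⟨ cong (replicate a 1 ++_) (rises-ups 1 m) ⟨
  replicate a 1 ++ rises 1 (replicate m true) ≡⟨ rises-flats-++ 1 a (replicate m true) ⟨
  rises 1 (replicate a false ++ replicate m true) ∎)
  where open ≡-Reasoning

pattern₂-shape : ∀ a m → pattern₂ (suc a) (suc m) ≡
                 shape 1 (replicate m true ++ replicate a false)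
pattern₂-shape a m = begin
  map suc (upTo m) ++ suc m ∷ replicate a (suc m)
    ≡⟨ cong₂ (λ us fs → us ++ suc m ∷ fs) (map-upTo suc m) (sym (rises-flats (suc m) a)) ⟩
  applyUpTo suc m ++ shape (suc m) (replicate a false)
    ≡⟨ shape-ups-++ 1 m (replicate a false) ⟨
  shape 1 (replicate m true ++ replicate a false) ∎
  where open ≡-Reasoning

theorem12 : (a m : ℕ) → 2 ≤ a → 2 ≤ m → pattern₁ a m ≡ₛ pattern₂ a m
theorem12 (suc a) (suc m) _ _ n k = begin
  countNC (pattern₁ (suc a) (suc m)) n k ≡⟨ cong (λ τ → countNC τ n k) (pattern₁-shape a m) ⟩
  countNC (shape 1 P) n k                ≡⟨ shape-reverse P 1 n k ⟩
  countNC (shape 1 (reverse P)) n k      ≡⟨ cong (λ Q → countNC (shape 1 Q) n k) reverse-P ⟩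
  countNC (shape 1 (replicate m true ++ replicate a false)) n k
                                         ≡⟨ cong (λ τ → countNC τ n k) (pattern₂-shape a m) ⟨
  countNC (pattern₂ (suc a) (suc m)) n k ∎
  where
  open ≡-Reasoning
  P = replicate a false ++ replicate m true

  reverse-P : reverse P ≡ replicate m true ++ replicate a false
  reverse-P = trans (reverse-++ (replicate a false) (replicate m true))
    (cong₂ _++_ (reverse-replicate m true) (reverse-replicate a false))
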